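{- Let $G$ be a finite simple biconnected chordal outerplanar graph with maximum degree $\Delta \in \{5,6\}$. If the weak dual $T^*(G)$ is not full, then either $G^2$ is a complete graph or $G$ has an $h$-separator for some $h \in \{4,5,6,7\}$.
   Context: $G^2$ is the graph on $V(G)$ in which two distinct vertices are adjacent iff their distance in $G$ is 1 or 2. For $G$ embedded in the plane with all vertices on the outer face, the weak dual $T^*(G)$ is the tree whose vertices are the bounded faces of $G$, two faces adjacent iff they share an edge. A tree is full if it has no vertex of degree 2. An $h$-separator of $G$ is a subgraph $H \subseteq G$ on $h$ vertices whose vertex set induces a clique in $G^2$ and whose removal disconnects $G^2$. -}

module Defs where

open import Data.Nat using (ℕ; suc; _≤_; _<_)
open import Data.Fin using (Fin; toℕ)
open import Data.Fin.Subset using (Subset; _∈_; _∉_; ∣_∣)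
open import Data.Vec using (tabulate)
open import Data.Bool using (Bool; true; false; T)
open import Data.Product using (Σ; ∃; _×_; _,_)
open import Data.Sum using (_⊎_)
open import Relation.Nullary using (¬_)
open import Relation.Binary.PropositionalEquality using (_≡_; _≢_)

record SimpleGraph (n : ℕ) : Set where
  field
    adj    : Fin n → Fin n → Bool
    sym    : ∀ u v → adj u v ≡ adj v u
    irrefl : ∀ v → adj v v ≡ false

data Walk {n : ℕ} (A : Fin n → Set) (E : Fin n → Fin n → Set) : Fin n → Fin n → Set where
  stop : ∀ {x} → A x → Walk A E x x
  step : ∀ {x y z} → A x → E x y → Walk A E y z → Walk A E x z

Connected : {n : ℕ} → (Fin n → Set) → (Fin n → Fin n → Set) → Set
Connected A E = ∀ x y → A x → A y → Walk A E x y

HasDegree2 : {X : Set} → (X → Set) → (X → X → Set) → X → Set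
HasDegree2 {X} V E x =
  Σ X λ y → Σ X λ z → V y × V z × y ≢ z × E x y × E x z ×
    (∀ w → V w → E x w → (w ≡ y) ⊎ (w ≡ z))

Full : {X : Set} → (X → Set) → (X → X → Set) → Set
Full {X} V E = ∀ x → V x → ¬ HasDegree2 V E x

InjectiveFn : {A B : Set} → (A → B) → Set
InjectiveFn f = ∀ a b → f a ≡ f b → a ≡ b

CycConsec : (k : ℕ) → Fin k → Fin k → Set
CycConsec k i j = (suc (toℕ i) ≡ toℕ j) ⊎ ((suc (toℕ i) ≡ k) × (toℕ j ≡ 0))

module _ {n : ℕ} (G : SimpleGraph n) where
  open SimpleGraph G

  Adj : Fin n → Fin n → Set
  Adj u v = T (adj u v)

  deg : Fin n → ℕ
  deg v = ∣ tabulate (adj v) ∣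

  HasMaxDegree : ℕ → Set
  HasMaxDegree Δ = (∀ v → deg v ≤ Δ) × (∃ λ v → deg v ≡ Δ)

  Biconnected : Set
  Biconnected = (3 ≤ n) × Connected (λ _ → Fin n) Adj
              × (∀ v → Connected (λ u → u ≢ v) Adj)

  Chordal : Set
  Chordal = ∀ (k : ℕ) (c : Fin k → Fin n) → 4 ≤ k → InjectiveFn c
          → (∀ i j → CycConsec k i j → Adj (c i) (c j))
          → Σ (Fin k) λ i → Σ (Fin k) λ j → i ≢ j × ¬ CycConsec k i j × ¬ CycConsec k j i
              × Adj (c i) (c j)

  Adj² : Fin n → Fin n → Set
  Adj² u v = u ≢ v × (Adj u v ⊎ Σ (Fin n) λ w → Adj u w × Adj w v)

  Complete² : Set
  Complete² = ∀ u v → u ≢ v → Adj² u v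

  HasSeparator : ℕ → Set
  HasSeparator h = Σ (Subset n) λ S → ∣ S ∣ ≡ h
    × (∀ u v → u ∈ S → v ∈ S → u ≢ v → Adj² u v)
    × Σ (Fin n) λ x → Σ (Fin n) λ y → x ∉ S × y ∉ S × ¬ Walk (λ w → w ∉ S) Adj² x y

  -- Outerplane embedding (all vertices on the outer face), encoded as a convex
  -- drawing: pos gives the cyclic position of each vertex on a circle.
  module _ (pos : Fin n → Fin n) where
    -- c lies strictly inside the arc between a and b (the arc not through position 0 wrap)
    Between : Fin n → Fin n → Fin n → Set
    Between a b c = ((toℕ (pos a) < toℕ (pos c)) × (toℕ (pos c) < toℕ (pos b)))
                  ⊎ ((toℕ (pos b) < toℕ (pos c)) × (toℕ (pos c) < toℕ (pos a)))

    NonCrossing : Set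
    NonCrossing = ∀ u v x y → Adj u v → Adj x y
                → x ≢ u → x ≢ v → y ≢ u → y ≢ v
                → Between u v x → Between u v y

    -- u, v (distinct, in S) are cyclically consecutive among the vertices of S
    ConsecIn : Subset n → Fin n → Fin n → Set
    ConsecIn S u v = (∀ w → w ∈ S → ¬ Between u v w)
                   ⊎ (∀ w → w ∈ S → w ≢ u → w ≢ v → Between u v w)

    -- bounded face of the embedding: vertex set S (≥ 3 vertices) whose boundary
    -- cycle (S in cyclic order) consists of edges of G and which has no chord
    IsFace : Subset n → Set
    IsFace S = (3 ≤ ∣ S ∣) × (∀ u v → u ∈ S → v ∈ S → u ≢ v
               → (Adj u v → ConsecIn S u v) × (ConsecIn S u v → Adj u v))

  DualAdj : Subset n → Subset n → Set
  DualAdj F F' = F ≢ F' × Σ (Fin n) λ u → Σ (Fin n) λ v → u ≢ v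
    × u ∈ F × v ∈ F × u ∈ F' × v ∈ F' × Adj u v

{-# OPTIONS --safe #-}
-- Every bounded face is a triangle. A face of degree 2 in the weak dual has corners u, v, w
-- such that uv lies on the outer face, while the edges uw and vw cut off nonempty sets A and B;
-- every other vertex is in A or in B. In G² an edge between A and B can only come from two
-- neighbours of w. If some vertex of A is not adjacent to w, then {u, v, w} ∪ (N(w) ∩ A) ⊆ N[w]
-- is a clique of G² separating that vertex from B, and it has between 4 and Δ + 1 vertices;
-- symmetrically for B. Otherwise N[w] is the whole graph and G² is complete.
module Submission where

open import Defs
open import Data.Nat using (ℕ; zero; suc; _+_; _∸_; _≤_; _<_; z≤n; s≤s; z<s; s≤s⁻¹; _≤?_; _<?_)
import Data.Nat as ℕ
open import Data.Nat.Properties hiding (_≟_; _≤?_; _<?_)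
open import Data.Nat.Induction using (<-rec)
open import Data.Fin using (Fin; zero; suc; toℕ; _≟_)
open import Data.Fin.Patterns using (0F; 1F; 2F)
open import Data.Fin.Properties using (toℕ-injective; toℕ<n; any?; all?)
open import Data.Fin.Subset using (Subset; _∈_; _∉_; _⊆_; ∣_∣; _-_; Nonempty; inside; outside)
open import Data.Fin.Subset.Properties using (_∈?_; Empty-unique; nonempty?; ∣⊥∣≡0; ⊆-antisym; p⊆q⇒∣p∣≤∣q∣; x∈p∧x≢y⇒x∈p-y; x∈p⇒∣p-x∣<∣p∣; p─q⊆p; p─⊥≡p; anySubset?)
open import Data.Vec using (tabulate; []; _∷_; there)
open import Data.Vec.Properties using (lookup∘tabulate; []=⇒lookup; lookup⇒[]=)
open import Data.Bool using (T)
open import Data.Bool.Properties using (T?; T-≡)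
open import Data.Product using (Σ; ∃-syntax; _×_; _,_; proj₁; proj₂)
open import Data.Sum using (_⊎_; inj₁; inj₂)
open import Data.Empty using (⊥; ⊥-elim)
open import Function using (_∘_; Equivalence)
open import Relation.Nullary using (¬_; Dec; yes; no; contradiction)
open import Relation.Nullary.Decidable using (_×-dec_; _⊎-dec_; _→-dec_; ¬?; from-yes; toWitness; fromWitness; decidable-stable; ⌊_⌋)
open import Relation.Unary using (Decidable)
open import Relation.Binary.Definitions using (tri<; tri≈; tri>)
open import Relation.Binary.PropositionalEquality using (_≡_; _≢_; refl; sym; trans; cong; subst; subst₂; ≢-sym)

-- Chordality and biconnectivity act through one fact: if edges leave a nonempty region only through
-- the ends of an edge `u v`, then `u` and `v` have a common neighbour in that region. Non-crossing
-- makes the arcs behind an edge such regions. The fact gives the third corner of a face, and it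
-- also shows that the side without a neighbouring face is on the outer face: a vertex behind it
-- would create one more triangle there, hence a third neighbour in the dual. The bound 4 counts the
-- three corners and the apex of the face across a side at `w`; the bound 7 is one more than the
-- maximum degree. The hypothesis that the dual is not full is a negation, so constructively a face
-- of degree 2 is available only under a double negation. The conclusion must therefore be
-- decidable, which the absence of walks is not on its face; hence separators are first produced
-- together with one side of the cut.

-- Finite subsets, triples of indices, sequences

module _ {n : ℕ} {P : Fin n → Set} (P? : Decidable P) where

  select : Subset n
  select = tabulate (⌊_⌋ ∘ P?)

  ∈-select⁺ : ∀ {x} → P x → x ∈ select
  ∈-select⁺ {x} px = lookup⇒[]= x select
    (trans (lookup∘tabulate (⌊_⌋ ∘ P?) x) (Equivalence.to T-≡ (fromWitness {a? = P? x} px)))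

  ∈-select⁻ : ∀ {x} → x ∈ select → P x
  ∈-select⁻ {x} x∈ = toWitness {a? = P? x} (Equivalence.from T-≡
    (trans (sym (lookup∘tabulate (⌊_⌋ ∘ P?) x)) ([]=⇒lookup x∈)))

  argmin : (key : Fin n → ℕ) → ∀ x → P x → ∃[ m ] P m × (∀ y → P y → key m ≤ key y)
  argmin key x px = <-rec Goal search (key x) x px refl
    where
    Goal : ℕ → Set
    Goal k = ∀ x → P x → key x ≡ k → ∃[ m ] P m × (∀ y → P y → key m ≤ key y)
    search : ∀ k → (∀ {j} → j < k → Goal j) → Goal k
    search k rec x px refl with any? (λ y → P? y ×-dec (key y <? key x))
    ... | yes (y , py , y<x) = rec y<x y py refl
    ... | no none = x , px , λ y py → ≮⇒≥ λ y<x → none (y , py , y<x)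

∣p∣≤1+∣p-x∣ : ∀ {n} (p : Subset n) x → ∣ p ∣ ≤ suc ∣ p - x ∣
∣p∣≤1+∣p-x∣ (inside  ∷ p) zero    = s≤s (≤-reflexive (sym (cong ∣_∣ (p─⊥≡p p))))
∣p∣≤1+∣p-x∣ (outside ∷ p) zero    = m≤n⇒m≤1+n (≤-reflexive (sym (cong ∣_∣ (p─⊥≡p p))))
∣p∣≤1+∣p-x∣ (inside  ∷ p) (suc x) = s≤s (∣p∣≤1+∣p-x∣ p x)
∣p∣≤1+∣p-x∣ (outside ∷ p) (suc x) = ∣p∣≤1+∣p-x∣ p x

x∉p-x : ∀ {n} (p : Subset n) x → x ∉ p - x
x∉p-x (inside  ∷ p) zero    ()
x∉p-x (outside ∷ p) zero    ()
x∉p-x (inside  ∷ p) (suc x) (there x∈) = x∉p-x p x x∈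
x∉p-x (outside ∷ p) (suc x) (there x∈) = x∉p-x p x x∈

∣p∣>0⇒Nonempty : ∀ {n} (p : Subset n) → 0 < ∣ p ∣ → Nonempty p
∣p∣>0⇒Nonempty {n} p 0<p with nonempty? p
... | yes ne = ne
... | no em = contradiction (subst (0 <_) (trans (cong ∣_∣ (Empty-unique em)) (∣⊥∣≡0 n)) 0<p) λ ()

abstract
  remaining-corner : ∀ (i j : Fin 3) → i ≢ j → ∃[ k ] k ≢ i × k ≢ j
  remaining-corner = from-yes
    (all? {3} λ i → all? {3} λ j → ¬? (i ≟ j) →-dec any? {3} λ k → ¬? (k ≟ i) ×-dec ¬? (k ≟ j))

  one-of-three : ∀ (i j k l : Fin 3) → i ≢ j → k ≢ i → k ≢ j → l ≡ i ⊎ l ≡ j ⊎ l ≡ k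
  one-of-three = from-yes
    (all? {3} λ i → all? {3} λ j → all? {3} λ k → all? {3} λ l →
      ¬? (i ≟ j) →-dec (¬? (k ≟ i) →-dec (¬? (k ≟ j) →-dec
        ((l ≟ i) ⊎-dec ((l ≟ j) ⊎-dec (l ≟ k))))))

-- Omits the `d + 1` entries strictly between `i` and `i + 2 + d`. Recording the gap instead of its
-- far end keeps the re-indexing free of subtraction.
splice : {A : Set} → (ℕ → A) → (i d : ℕ) → ℕ → A
splice f i d m with m ≤? i
... | yes _ = f m
... | no  _ = f (suc d + m)

splice-≤ : {A : Set} (f : ℕ → A) (i d : ℕ) {m : ℕ} → m ≤ i → splice f i d m ≡ f m
splice-≤ f i d {m} m≤i with m ≤? i
... | yes _ = refl
... | no m≰i = contradiction m≤i m≰i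

splice-> : {A : Set} (f : ℕ → A) (i d : ℕ) {m : ℕ} → i < m → splice f i d m ≡ f (suc d + m)
splice-> f i d {m} i<m with m ≤? i
... | yes m≤i = contradiction m≤i (<⇒≱ i<m)
... | no _ = refl

-- Adjacency, and separators of the square as decidable cuts

module GraphTheory {n : ℕ} (G : SimpleGraph n) where
  open SimpleGraph G using (adj; irrefl) renaming (sym to adj-sym)

  infix 4 _~_ _~?_

  _~_ : Fin n → Fin n → Set
  _~_ = Adj G

  _~?_ : ∀ u v → Dec (u ~ v)
  u ~? v = T? (adj u v)

  ~-sym : ∀ {u v} → u ~ v → v ~ u
  ~-sym {u} {v} = subst T (adj-sym u v)

  ~⇒≢ : ∀ {u v} → u ~ v → u ≢ v
  ~⇒≢ {u} u~u refl = subst T (irrefl u) u~u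

  Adj²? : ∀ u v → Dec (Adj² G u v)
  Adj²? u v = ¬? (u ≟ v) ×-dec (u ~? v ⊎-dec any? λ w → (u ~? w) ×-dec (w ~? v))

  -- A certificate that S is a separator, P collecting the vertices on one side. Unlike
  -- HasSeparator it involves no walk, so its existence is decidable by exhaustive search.
  Cut : Subset n → Subset n → Set
  Cut S P = 4 ≤ ∣ S ∣ × ∣ S ∣ ≤ 7
    × (∀ u v → u ∈ S → v ∈ S → u ≢ v → Adj² G u v)
    × (∃[ x ] x ∉ S × x ∈ P) × (∃[ y ] y ∉ S × y ∉ P)
    × (∀ x y → x ∉ S → y ∉ S → x ∈ P → Adj² G x y → y ∈ P)

  Cut? : ∀ S P → Dec (Cut S P)
  Cut? S P = (4 ≤? ∣ S ∣) ×-dec (∣ S ∣ ≤? 7)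
    ×-dec (all? λ u → all? λ v → (u ∈? S) →-dec ((v ∈? S) →-dec (¬? (u ≟ v) →-dec Adj²? u v)))
    ×-dec (any? λ x → ¬? (x ∈? S) ×-dec (x ∈? P)) ×-dec (any? λ y → ¬? (y ∈? S) ×-dec ¬? (y ∈? P))
    ×-dec (all? λ x → all? λ y →
      ¬? (x ∈? S) →-dec (¬? (y ∈? S) →-dec ((x ∈? P) →-dec (Adj²? x y →-dec (y ∈? P)))))

  CompleteOrCut : Set
  CompleteOrCut = Complete² G ⊎ ∃[ S ] ∃[ P ] Cut S P

  CompleteOrCut? : Dec CompleteOrCut
  CompleteOrCut? = (all? λ u → all? λ v → ¬? (u ≟ v) →-dec Adj²? u v)
    ⊎-dec anySubset? λ S → anySubset? λ P → Cut? S P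

  walk-source : ∀ {A : Fin n → Set} {E x y} → Walk A E x y → A x
  walk-source (stop ax)     = ax
  walk-source (step ax _ _) = ax

  walk-stays : ∀ {S P x y} → (∀ x y → x ∉ S → y ∉ S → x ∈ P → Adj² G x y → y ∈ P)
             → Walk (_∉ S) (Adj² G) x y → x ∈ P → y ∈ P
  walk-stays closed (stop _) x∈P = x∈P
  walk-stays closed (step x∉S e w) x∈P =
    walk-stays closed w (closed _ _ x∉S (walk-source w) x∈P e)

  Cut⇒HasSeparator : ∀ {S P} → Cut S P → Σ ℕ (λ h → 4 ≤ h × h ≤ 7 × HasSeparator G h)
  Cut⇒HasSeparator {S} (4≤S , S≤7 , clique , (x , x∉S , x∈P) , (y , y∉S , y∉P) , closed) =
    ∣ S ∣ , 4≤S , S≤7 , S , refl , clique , x , y , x∉S , y∉S ,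
    λ w → y∉P (walk-stays closed w x∈P)

  -- Common neighbours behind an edge

  module Region (C : Fin n → Set) where

    -- A walk to `t` whose vertices before the last one all lie in `C`.
    data Approach (t : Fin n) : Fin n → Set where
      near : ∀ {c} → C c → c ~ t → Approach t c
      far  : ∀ {c d} → C c → c ~ d → Approach t d → Approach t c

    approach-last : ∀ {t c} → Approach t c → ∃[ d ] C d × d ~ t
    approach-last (near cc c~t) = _ , cc , c~t
    approach-last (far _ _ a)   = approach-last a

    -- The walk starts in `C`, ends outside it and avoids `s`, so its first exit from `C` is at `t`;
    -- whatever follows is dropped.
    walk⇒approach : ∀ {s t c} → (∀ {x y} → C x → x ~ y → C y ⊎ y ≡ s ⊎ y ≡ t) → ¬ C t
                  → C c → Walk (_≢ s) _~_ c t → Approach t c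
    walk⇒approach closed ¬ct cc (stop _) = contradiction cc ¬ct
    walk⇒approach closed ¬ct cc (step _ c~d w) with closed cc c~d
    ... | inj₁ cd          = far cc c~d (walk⇒approach closed ¬ct cd w)
    ... | inj₂ (inj₁ refl) = contradiction refl (walk-source w)
    ... | inj₂ (inj₂ refl) = near cc c~d

    -- Vertices may repeat, since repetitions are cut out later. Values of `at` beyond `k` are junk,
    -- so shortening is mere re-indexing.
    record Detour (u v : Fin n) (k : ℕ) : Set where
      field
        at    : ℕ → Fin n
        start : at 0 ≡ u
        end   : at k ≡ v
        inner : ∀ {m} → 0 < m → m < k → C (at m)
        edge  : ∀ {m} → m < k → at m ~ at (suc m)

    approach⇒detour : ∀ {u v c} → u ~ c → Approach v c → ∃[ k ] 2 ≤ k × Detour u v k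
    approach⇒detour {u} {v} {c} u~c (near cc c~v) = 2 , ≤-refl , record
      { at = λ { 0 → u ; 1 → c ; _ → v } ; start = refl ; end = refl
      ; inner = λ { {1} _ _ → cc ; {suc (suc _)} _ (s≤s (s≤s ())) }
      ; edge = λ { {0} _ → u~c ; {1} _ → c~v ; {suc (suc _)} (s≤s (s≤s ())) } }
    approach⇒detour {u} {v} {c} u~c (far cc c~d a) with approach⇒detour c~d a
    ... | k , 2≤k , D = suc k , m≤n⇒m≤1+n 2≤k , record
      { at = λ { 0 → u ; (suc m) → at m } ; start = refl ; end = end
      ; inner = λ { {1} _ _ → subst C (sym start) cc ; {suc (suc m)} _ (s≤s m<k) → inner z<s m<k }
      ; edge = λ { {0} _ → subst (u ~_) (sym start) u~c ; {suc m} (s≤s m<k) → edge m<k } }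
      where
      open Detour D

    -- The edge from `at i` to `at j` replaces the segment between them. The condition
    -- `0 < i ⊎ j < k` excludes only the jump from one end to the other, which would leave length 1
    -- and no vertex in `C`.
    shortcut : ∀ {u v k} (D : Detour u v k) {i j} → suc (suc i) ≤ j → j ≤ k
             → 0 < i ⊎ j < k → Detour.at D i ~ Detour.at D j → ∃[ k′ ] k′ < k × 2 ≤ k′ × Detour u v k′
    shortcut D {i} i+2≤j j≤k proper i~j
      with m≤n⇒∃[o]m+o≡n i+2≤j | m≤n⇒∃[o]m+o≡n j≤k
    ... | d , refl | e , refl = suc i + e , shorter , long proper , record
      { at = at′
      ; start = trans (≤-case z≤n) start
      ; end = trans (>-case (s≤s (m≤m+n i e))) (trans (cong at shift) end)
      ; inner = inner′ ; edge = edge′ }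
      where
      open Detour D
      at′ = splice at i d
      ≤-case = λ {m} → splice-≤ at i d {m}
      >-case = λ {m} → splice-> at i d {m}
      shift : suc d + (suc i + e) ≡ suc (suc (i + d)) + e
      shift = cong suc (trans (sym (+-assoc d (suc i) e))
        (cong (_+ e) (trans (+-suc d i) (cong suc (+-comm d i)))))
      shorter : suc i + e < suc (suc (i + d)) + e
      shorter = s≤s (s≤s (+-monoˡ-≤ e (m≤m+n i d)))
      long : 0 < i ⊎ suc (suc (i + d)) < suc (suc (i + d)) + e → 2 ≤ suc i + e
      long (inj₁ 0<i) = s≤s (≤-trans 0<i (m≤m+n i e))
      long (inj₂ j<k) = s≤s (≤-trans
        (+-cancelˡ-< (suc (suc (i + d))) 0 e (subst (_< suc (suc (i + d)) + e) (sym (+-identityʳ _)) j<k))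
        (m≤n+m e i))
      late : ∀ {m} → m < suc i + e → suc d + m < suc (suc (i + d)) + e
      late {m} m< = subst (suc d + m <_) shift (+-monoʳ-< (suc d) m<)
      inner′ : ∀ {m} → 0 < m → m < suc i + e → C (at′ m)
      inner′ {m} 0<m m< with m ≤? i
      ... | yes m≤i = inner 0<m (<-trans m< shorter)
      ... | no  _   = inner z<s (late m<)
      edge′ : ∀ {m} → m < suc i + e → at′ m ~ at′ (suc m)
      edge′ {m} m< with <-cmp m i
      ... | tri< m<i _ _ = subst₂ _~_ (sym (≤-case (<⇒≤ m<i))) (sym (≤-case m<i))
                             (edge (<-trans m< shorter))
      -- The seam: the only edge of the new sequence that is not an edge of the old one.
      ... | tri≈ _ refl _ = subst₂ _~_ (sym (≤-case ≤-refl))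
                             (sym (trans (>-case (n<1+n m)) (cong at (cong suc (trans (+-suc d m) (cong suc (+-comm d m)))))))
                             i~j
      ... | tri> _ _ i<m = subst₂ _~_ (sym (>-case i<m))
                             (sym (trans (>-case (m<n⇒m<1+n i<m)) (cong at (+-suc (suc d) m))))
                             (edge (late m<))

    -- A detour of length at least 3 closes up with the edge uv to a cycle; if two of its
    -- vertices coincide or, by chordality, some chord exists, then it can be shortened.
    detour⇒common-neighbour : Chordal G → ∀ {u v} → u ~ v → ¬ C u → ¬ C v
      → ∀ k → 2 ≤ k → Detour u v k → ∃[ z ] C z × z ~ u × z ~ v
    detour⇒common-neighbour chordal {u} {v} u~v ¬cu ¬cv = <-rec _ shorten
      where
      Goal = ∃[ z ] C z × z ~ u × z ~ v
      shorten : ∀ k → (∀ {j} → j < k → 2 ≤ j → Detour u v j → Goal) → 2 ≤ k → Detour u v k → Goal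
      shorten k rec 2≤k D with m≤n⇒m<n∨m≡n 2≤k
      ... | inj₂ refl = at 1 , inner z<s ≤-refl , subst (at 1 ~_) start (~-sym (edge z<s))
                      , subst (at 1 ~_) end (edge ≤-refl)
        where
        open Detour D
      ... | inj₁ 3≤k = by-repetition (any? λ i → any? λ j → (toℕ i <? toℕ j) ×-dec (c i ≟ c j))
        where
        open Detour D
        c : Fin (suc k) → Fin n
        c = at ∘ toℕ
        use : ∀ {i j} → suc (suc i) ≤ j → j ≤ k → 0 < i ⊎ j < k → at i ~ at j → Goal
        use p q r s with shortcut D p q r s
        ... | k′ , k′<k , 2≤k′ , D′ = rec k′<k 2≤k′ D′
        repetition : ∀ i j → i < j → j ≤ k → at i ≡ at j → Goal
        repetition zero j 0<j j≤k eq with m≤n⇒m<n∨m≡n j≤k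
        ... | inj₁ j<k  = contradiction (subst C (trans (sym eq) start) (inner 0<j j<k)) ¬cu
        ... | inj₂ refl = contradiction (trans (sym start) (trans eq end)) (~⇒≢ u~v)
        repetition (suc i) j i<j j≤k eq with m≤n⇒m<n∨m≡n j≤k
        -- The predecessor of the first copy is adjacent to the second copy, so the loop between the
        -- copies can be skipped.
        ... | inj₁ j<k  = use i<j j≤k (inj₂ j<k)
                            (subst (at i ~_) eq (edge (<-trans (n<1+n i) (<-≤-trans i<j j≤k))))
        ... | inj₂ refl = contradiction (subst C (trans eq end) (inner z<s i<j)) ¬cv
        bound : ∀ (i : Fin (suc k)) → toℕ i ≤ k
        bound i = s≤s⁻¹ (toℕ<n i)
        chord : ∀ i j → toℕ i < toℕ j → ¬ CycConsec (suc k) i j → ¬ CycConsec (suc k) j i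
              → c i ~ c j → Goal
        chord i j i<j ¬ij ¬ji i~j = use (≤∧≢⇒< i<j (¬ij ∘ inj₁)) (bound j) proper i~j
          where
          proper : 0 < toℕ i ⊎ toℕ j < k
          proper with toℕ i ℕ.≟ 0
          ... | no i≢0 = inj₁ (n≢0⇒n>0 i≢0)
          -- If also `j` were `k`, the chord would be the closing edge of the cycle, which joins
          -- consecutive vertices.
          ... | yes i≡0 = inj₂ (≤∧≢⇒< (bound j) λ j≡k → ¬ji (inj₂ (cong suc j≡k , i≡0)))
        by-repetition : Dec (∃[ i ] ∃[ j ] toℕ i < toℕ j × c i ≡ c j) → Goal
        by-repetition (yes (i , j , i<j , eq)) = repetition (toℕ i) (toℕ j) i<j (bound j) eq
        by-repetition (no distinct) with chordal (suc k) c (s≤s 3≤k) injective cyclic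
          where
          injective : InjectiveFn c
          injective i j eq with <-cmp (toℕ i) (toℕ j)
          ... | tri< i<j _ _ = contradiction (i , j , i<j , eq) distinct
          ... | tri≈ _ i≡j _ = toℕ-injective i≡j
          ... | tri> _ _ j<i = contradiction (j , i , j<i , sym eq) distinct
          cyclic : ∀ i j → CycConsec (suc k) i j → c i ~ c j
          cyclic i j (inj₁ i+1≡j) = subst (λ m → c i ~ at m) i+1≡j
            (edge (subst (_≤ k) (sym i+1≡j) (bound j)))
          cyclic i j (inj₂ (i+1≡k+1 , j≡0)) = subst₂ _~_
            (sym (trans (cong at (suc-injective i+1≡k+1)) end)) (sym (trans (cong at j≡0) start)) (~-sym u~v)
        ... | i , j , i≢j , ¬ij , ¬ji , i~j with <-cmp (toℕ i) (toℕ j)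
        ... | tri< i<j _ _ = chord i j i<j ¬ij ¬ji i~j
        ... | tri≈ _ i≡j _ = contradiction (toℕ-injective i≡j) i≢j
        ... | tri> _ _ j<i = chord j i j<i ¬ji ¬ij (~-sym i~j)

    -- Deleting `v` leaves a walk from `c` to `u`, which gives a neighbour `d` of `u` in `C`.
    -- Deleting `u` leaves a walk from `d` to `v` that stays in `C` until it reaches `v`. Together
    -- they form a detour from `u` to `v`.
    common-neighbour : Biconnected G → Chordal G → ∀ {u v c} → u ~ v → ¬ C u → ¬ C v
      → (∀ {x y} → C x → x ~ y → C y ⊎ y ≡ u ⊎ y ≡ v) → C c → ∃[ z ] C z × z ~ u × z ~ v
    common-neighbour (_ , _ , robust) chordal {u} {v} {c} u~v ¬cu ¬cv closed cc
      with approach-last (walk⇒approach closed′ ¬cu cc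
             (robust v c u (λ { refl → ¬cv cc }) (~⇒≢ u~v)))
      where
      closed′ : ∀ {x y} → C x → x ~ y → C y ⊎ y ≡ v ⊎ y ≡ u
      closed′ cx x~y with closed cx x~y
      ... | inj₁ cy        = inj₁ cy
      ... | inj₂ (inj₁ eq) = inj₂ (inj₂ eq)
      ... | inj₂ (inj₂ eq) = inj₂ (inj₁ eq)
    ... | d , cd , d~u
      with approach⇒detour (~-sym d~u) (walk⇒approach closed ¬cv cd
             (robust u d v (~⇒≢ d~u) (~⇒≢ (~-sym u~v))))
    ... | k , 2≤k , D = detour⇒common-neighbour chordal u~v ¬cu ¬cv k 2≤k D

  -- Triangles

  -- Numbering the corners lets a side be named by the corner opposite to it, so that arguments
  -- about the three sides are stated once.
  record Triangle (e : Fin 3 → Fin n) (F : Subset n) : Set where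
    field
      sides    : ∀ {i j} → i ≢ j → e i ~ e j
      corner∈  : ∀ i → e i ∈ F
      ∈-corner : ∀ {x} → x ∈ F → ∃[ i ] x ≡ e i

    corner-injective : ∀ {i j} → e i ≡ e j → i ≡ j
    corner-injective {i} {j} eq = decidable-stable (i ≟ j) λ i≢j → ~⇒≢ (sides i≢j) eq

  -- Non-crossing edges in convex position

  module Outerplane (pos : Fin n → Fin n) (pos-injective : InjectiveFn pos) (nc : NonCrossing G pos) where

    # : Fin n → ℕ
    # x = toℕ (pos x)

    #-injective : ∀ {x y} → # x ≡ # y → x ≡ y
    #-injective eq = pos-injective _ _ (toℕ-injective eq)

    #<⇒≢ : ∀ {x y} → # x < # y → x ≢ y
    #<⇒≢ x<y refl = <-irrefl refl x<y

    #≤∧≢⇒< : ∀ {x y} → # x ≤ # y → x ≢ y → # x < # y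
    #≤∧≢⇒< x≤y x≢y = ≤∧≢⇒< x≤y (x≢y ∘ #-injective)

    Inside : Fin n → Fin n → Fin n → Set
    Inside p q x = # p < # x × # x < # q

    confined : ∀ {p q x y} → p ~ q → Inside p q x → x ~ y → Inside p q y ⊎ y ≡ p ⊎ y ≡ q
    confined {p} {q} {x} {y} p~q (p<x , x<q) x~y with y ≟ p | y ≟ q
    ... | yes eq | _      = inj₂ (inj₁ eq)
    ... | no _   | yes eq = inj₂ (inj₂ eq)
    ... | no y≢p | no y≢q
      with nc p q x y p~q x~y (≢-sym (#<⇒≢ p<x)) (#<⇒≢ x<q) y≢p y≢q (inj₁ (p<x , x<q))
    ... | inj₁ in′         = inj₁ in′
    ... | inj₂ (q<y , y<p) = contradiction (<-trans q<y y<p) (<-asym (<-trans p<x x<q))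

    crossing : ∀ {a b c d} → # a < # b → # b < # c → # c < # d → a ~ c → b ~ d → ⊥
    crossing a<b b<c c<d a~c b~d with confined a~c (a<b , b<c) b~d
    ... | inj₁ (_ , d<c)    = <-asym c<d d<c
    ... | inj₂ (inj₁ refl)  = <-asym (<-trans b<c c<d) a<b
    ... | inj₂ (inj₂ refl)  = <-irrefl refl c<d

    not-between : ∀ {s t} {F : Subset n} → # s < # t → (∀ w → w ∈ F → ¬ Inside s t w)
                → ∀ w → w ∈ F → ¬ Between G pos s t w
    not-between s<t gap w w∈ (inj₁ in′)         = gap w w∈ in′
    not-between s<t gap w w∈ (inj₂ (t<w , w<s)) = <-asym s<t (<-trans t<w w<s)

    Between? : ∀ u v w → Dec (Between G pos u v w)
    Between? u v w = ((# u <? # w) ×-dec (# w <? # v)) ⊎-dec ((# v <? # w) ×-dec (# w <? # u))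

    -- Any two of three points on a circle are consecutive: the third either lies between them or
    -- does not, and each case is one of the alternatives of `ConsecIn`.
    triangle-isFace : ∀ {e F} → Triangle e F → IsFace G pos F
    triangle-isFace {e} {F} tr = size , λ u v u∈ v∈ u≢v →
      (λ _ → consecutive u∈ v∈ u≢v) , (λ _ → adjacent u∈ v∈ u≢v)
      where
      open Triangle tr
      ≢-corner : ∀ {i j} → i ≢ j → e i ≢ e j
      ≢-corner i≢j = ~⇒≢ (sides i≢j)
      size : 3 ≤ ∣ F ∣
      -- Removing the three distinct corners one by one lowers the cardinality each time.
      size = ≤-trans (s≤s (≤-trans (s≤s (≤-trans (s≤s z≤n)
          (x∈p⇒∣p-x∣<∣p∣ (x∈p∧x≢y⇒x∈p-y (x∈p∧x≢y⇒x∈p-y (corner∈ 2F) (≢-corner λ ())) (≢-corner λ ())))))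
          (x∈p⇒∣p-x∣<∣p∣ (x∈p∧x≢y⇒x∈p-y (corner∈ 1F) (≢-corner λ ())))))
          (x∈p⇒∣p-x∣<∣p∣ (corner∈ 0F))
      adjacent : ∀ {u v} → u ∈ F → v ∈ F → u ≢ v → u ~ v
      adjacent u∈ v∈ u≢v with ∈-corner u∈ | ∈-corner v∈
      ... | i , refl | j , refl = sides (u≢v ∘ cong e)
      ¬between-left : ∀ {u v} → ¬ Between G pos u v u
      ¬between-left (inj₁ (u<u , _)) = <-irrefl refl u<u
      ¬between-left (inj₂ (_ , u<u)) = <-irrefl refl u<u
      ¬between-right : ∀ {u v} → ¬ Between G pos u v v
      ¬between-right (inj₁ (_ , v<v)) = <-irrefl refl v<v
      ¬between-right (inj₂ (v<v , _)) = <-irrefl refl v<v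
      consecutive : ∀ {u v} → u ∈ F → v ∈ F → u ≢ v → ConsecIn G pos F u v
      consecutive u∈ v∈ u≢v with ∈-corner u∈ | ∈-corner v∈
      ... | i , refl | j , refl with remaining-corner i j (u≢v ∘ cong e)
      ... | k , k≢i , k≢j with Between? (e i) (e j) (e k)
      ... | yes btw = inj₂ go
        where
        go : ∀ w → w ∈ F → w ≢ e i → w ≢ e j → Between G pos (e i) (e j) w
        go w w∈ w≢i w≢j with ∈-corner w∈
        ... | l , refl with one-of-three i j k l (u≢v ∘ cong e) k≢i k≢j
        ... | inj₁ refl        = contradiction refl w≢i
        ... | inj₂ (inj₁ refl) = contradiction refl w≢j
        ... | inj₂ (inj₂ refl) = btw
      ... | no ¬btw = inj₁ go
        where
        go : ∀ w → w ∈ F → ¬ Between G pos (e i) (e j) w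
        go w w∈ with ∈-corner w∈
        ... | l , refl with one-of-three i j k l (u≢v ∘ cong e) k≢i k≢j
        ... | inj₁ refl        = ¬between-left
        ... | inj₂ (inj₁ refl) = ¬between-right
        ... | inj₂ (inj₂ refl) = ¬btw

    corners : Fin n → Fin n → Fin n → Fin 3 → Fin n
    corners a b c 0F = a
    corners a b c 1F = b
    corners a b c 2F = c

    triangle : ∀ {a b c F} → a ~ b → b ~ c → a ~ c → a ∈ F → b ∈ F → c ∈ F
             → (∀ {x} → x ∈ F → x ≡ a ⊎ x ≡ b ⊎ x ≡ c) → Triangle (corners a b c) F
    triangle {a} {b} {c} {F} a~b b~c a~c a∈ b∈ c∈ only =
      record { sides = s ; corner∈ = m ; ∈-corner = o }
      where
      s : ∀ {i j} → i ≢ j → corners a b c i ~ corners a b c j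
      s {0F} {0F} i≢j = contradiction refl i≢j
      s {0F} {1F} _ = a~b
      s {0F} {2F} _ = a~c
      s {1F} {0F} _ = ~-sym a~b
      s {1F} {1F} i≢j = contradiction refl i≢j
      s {1F} {2F} _ = b~c
      s {2F} {0F} _ = ~-sym a~c
      s {2F} {1F} _ = ~-sym b~c
      s {2F} {2F} i≢j = contradiction refl i≢j
      m : ∀ i → corners a b c i ∈ F
      m 0F = a∈
      m 1F = b∈
      m 2F = c∈
      o : ∀ {x} → x ∈ F → ∃[ i ] x ≡ corners a b c i
      o x∈ with only x∈
      ... | inj₁ eq        = 0F , eq
      ... | inj₂ (inj₁ eq) = 1F , eq
      ... | inj₂ (inj₂ eq) = 2F , eq

    argmax : ∀ {P : Fin n → Set} → Decidable P → ∀ x → P x → ∃[ m ] P m × (∀ y → P y → # y ≤ # m)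
    argmax P? x px with argmin P? (λ y → n ∸ # y) x px
    ... | m , pm , min = m , pm , λ y py → ≮⇒≥ λ m<y →
      <⇒≱ (∸-monoʳ-< m<y (<⇒≤ (toℕ<n (pos y)))) (min y py)

    Increasing : (Fin 3 → Fin n) → Set
    Increasing e = # (e 0F) < # (e 1F) × # (e 1F) < # (e 2F)

    -- Bounded faces are triangles

    module _ (bic : Biconnected G) (chordal : Chordal G) where

      -- The extreme vertices u, v of a face are joined by an edge, so u and v have a common
      -- neighbour z strictly between them. Were z not on the face, one of the edges zu, zv
      -- would cross the side of the face that passes over z.
      face⇒triangle : ∀ {F} → IsFace G pos F → ∃[ e ] Increasing e × Triangle e F
      face⇒triangle {F} (3≤F , sides)
        with ∣p∣>0⇒Nonempty F (<-trans z<s 3≤F)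
      ... | f , f∈ with argmin (_∈? F) # f f∈ | argmax (_∈? F) f f∈
      ... | u , u∈ , u-min | v , v∈ , v-max
        -- A third vertex of `F`: it shows that the region between `u` and `v` is nonempty.
        with ∣p∣>0⇒Nonempty (F - u - v) (s≤s⁻¹ (s≤s⁻¹ (≤-trans 3≤F
               (≤-trans (∣p∣≤1+∣p-x∣ F u) (s≤s (∣p∣≤1+∣p-x∣ (F - u) v))))))
      ... | r , r∈′ = found (Region.common-neighbour (Inside u v) bic chordal u~v
              (λ { (u<u , _) → <-irrefl refl u<u }) (λ { (_ , v<v) → <-irrefl refl v<v })
              (λ cx x~y → confined u~v cx x~y) (u<r , r<v))
        where
        r∈u : r ∈ F - u
        r∈u = p─q⊆p (F - u) _ r∈′
        r∈ : r ∈ F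
        r∈ = p─q⊆p F _ r∈u
        u<r : # u < # r
        u<r = #≤∧≢⇒< (u-min r r∈) λ { refl → x∉p-x F u r∈u }
        r<v : # r < # v
        r<v = #≤∧≢⇒< (v-max r r∈) λ { refl → x∉p-x (F - u) v r∈′ }
        u<v : # u < # v
        u<v = <-trans u<r r<v
        -- No vertex of `F` lies on the arc from `v` to `u` across position 0, so these two are
        -- consecutive on the face.
        u~v : u ~ v
        u~v = proj₂ (sides u v u∈ v∈ (#<⇒≢ u<v)) (inj₂ λ w w∈ w≢u w≢v →
          inj₁ (#≤∧≢⇒< (u-min w w∈) (≢-sym w≢u) , #≤∧≢⇒< (v-max w w∈) w≢v))

        module _ {z} (u<z : # u < # z) (z<v : # z < # v) (z~u : z ~ u) (z~v : z ~ v) where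

          under-side : ∀ {s t} → s ∈ F → t ∈ F → # s < # z → # z < # t
                     → (∀ w → w ∈ F → ¬ Inside s t w) → s ~ t → ⊥
          under-side {s} {t} s∈ t∈ s<z z<t gap s~t with s ≟ u | t ≟ v
          -- The side over `z` is not `u v` itself, because `r` lies in between.
          ... | yes refl | yes refl = gap r r∈ (u<r , r<v)
          ... | no s≢u   | _        =
            crossing (#≤∧≢⇒< (u-min s s∈) (≢-sym s≢u)) s<z z<t (~-sym z~u) s~t
          ... | yes refl | no t≢v   =
            crossing s<z z<t (#≤∧≢⇒< (v-max t t∈) t≢v) s~t z~v

          z∈ : z ∈ F
          z∈ with z ∈? F
          ... | yes z∈F = z∈F
          -- `s` and `t` are the vertices of `F` closest to `z` on either side, hence consecutive on
          -- the face.
          ... | no z∉ with argmax (λ x → (x ∈? F) ×-dec (# x <? # z)) u (u∈ , u<z)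
                         | argmin (λ x → (x ∈? F) ×-dec (# z <? # x)) # v (v∈ , z<v)
          ... | s , (s∈ , s<z) , s-max | t , (t∈ , z<t) , t-min =
            ⊥-elim (under-side s∈ t∈ s<z z<t gap (proj₂ (sides s t s∈ t∈ (#<⇒≢ s<t)) (inj₁ (not-between s<t gap))))
            where
            s<t : # s < # t
            s<t = <-trans s<z z<t
            gap : ∀ w → w ∈ F → ¬ Inside s t w
            gap w w∈ (s<w , w<t) with <-cmp (# w) (# z)
            ... | tri< w<z _ _ = <⇒≱ s<w (s-max w (w∈ , w<z))
            ... | tri≈ _ w≡z _ = z∉ (subst (_∈ F) (#-injective w≡z) w∈)
            ... | tri> _ _ z<w = <⇒≱ w<t (t-min w (w∈ , z<w))

          -- A face has no chord, so the edges `u z` and `z v` join consecutive vertices. A further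
          -- vertex would lie on one side of such an edge with `v` or `u` on the other.
          only : ∀ {x} → x ∈ F → x ≡ u ⊎ x ≡ z ⊎ x ≡ v
          only {x} x∈ with x ≟ u | x ≟ v
          ... | yes eq | _      = inj₁ eq
          ... | no _   | yes eq = inj₂ (inj₂ eq)
          ... | no x≢u | no x≢v with <-cmp (# x) (# z)
          ... | tri≈ _ x≡z _ = inj₂ (inj₁ (#-injective x≡z))
          ... | tri< x<z _ _ with proj₁ (sides u z u∈ z∈ (#<⇒≢ u<z)) (~-sym z~u)
          ...   | inj₁ none = ⊥-elim (none x x∈ (inj₁ (#≤∧≢⇒< (u-min x x∈) (≢-sym x≢u) , x<z)))
          ...   | inj₂ every with every v v∈ (≢-sym (#<⇒≢ u<v)) (≢-sym (#<⇒≢ z<v))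
          ...     | inj₁ (_ , v<z) = contradiction v<z (<-asym z<v)
          ...     | inj₂ (_ , v<u) = contradiction v<u (<-asym u<v)
          only {x} x∈ | no x≢u | no x≢v | tri> _ _ z<x with proj₁ (sides z v z∈ v∈ (#<⇒≢ z<v)) z~v
          ...   | inj₁ none = ⊥-elim (none x x∈ (inj₁ (z<x , #≤∧≢⇒< (v-max x x∈) x≢v)))
          ...   | inj₂ every with every u u∈ (#<⇒≢ u<z) (#<⇒≢ u<v)
          ...     | inj₁ (z<u , _) = contradiction z<u (<-asym u<z)
          ...     | inj₂ (v<u , _) = contradiction v<u (<-asym u<v)

        found : ∃[ z ] Inside u v z × z ~ u × z ~ v → ∃[ e ] Increasing e × Triangle e F
        found (z , (u<z , z<v) , z~u , z~v) = corners u z v , (u<z , z<v) ,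
          triangle (~-sym z~u) z~v u~v u∈ (z∈ u<z z<v z~u z~v) v∈ (only u<z z<v z~u z~v)

    -- The regions beyond the three sides of a triangle

    -- `Sector i` is the region behind the side opposite `e i`. This interface hides the linear
    -- order of positions, which breaks the symmetry between the corners.
    record Trisection (e : Fin 3 → Fin n) : Set₁ where
      field
        Sector   : Fin 3 → Fin n → Set
        sector?  : ∀ i → Decidable (Sector i)
        locate   : ∀ x → (∃[ i ] x ≡ e i) ⊎ (∃[ i ] Sector i x)
        corner∉  : ∀ {i j} → ¬ Sector i (e j)
        disjoint : ∀ {i j x} → Sector i x → Sector j x → i ≡ j
        sep      : ∀ {i x y} → Sector i x → x ~ y → Sector i y ⊎ (∃[ j ] j ≢ i × y ≡ e j)
        apex-unique : ∀ {i x y} → Sector i x → Sector i y → (∀ {j} → j ≢ i → x ~ e j)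
                    → (∀ {j} → j ≢ i → y ~ e j) → x ≡ y

    module _ {e : Fin 3 → Fin n} (inc : Increasing e) (sides : ∀ {i j} → i ≢ j → e i ~ e j) where
      private
        a = e 0F
        b = e 1F
        c = e 2F
        a<b = proj₁ inc
        b<c = proj₂ inc
        a<c = <-trans a<b b<c

        Sector : Fin 3 → Fin n → Set
        Sector 0F x = Inside b c x
        -- The arc from `c` to `a` passes through position 0, so it splits into two intervals.
        Sector 1F x = # x < # a ⊎ # c < # x
        Sector 2F x = Inside a b x

        sector? : ∀ i → Decidable (Sector i)
        sector? 0F x = (# b <? # x) ×-dec (# x <? # c)
        sector? 1F x = (# x <? # a) ⊎-dec (# c <? # x)
        sector? 2F x = (# a <? # x) ×-dec (# x <? # b)

        locate : ∀ x → (∃[ i ] x ≡ e i) ⊎ (∃[ i ] Sector i x)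
        locate x with <-cmp (# x) (# a) | <-cmp (# x) (# b) | <-cmp (# x) (# c)
        ... | tri< x<a _ _ | _            | _            = inj₂ (1F , inj₁ x<a)
        ... | tri≈ _ x≡a _ | _            | _            = inj₁ (0F , #-injective x≡a)
        ... | tri> _ _ a<x | tri< x<b _ _ | _            = inj₂ (2F , a<x , x<b)
        ... | tri> _ _ a<x | tri≈ _ x≡b _ | _            = inj₁ (1F , #-injective x≡b)
        ... | tri> _ _ a<x | tri> _ _ b<x | tri< x<c _ _ = inj₂ (0F , b<x , x<c)
        ... | tri> _ _ a<x | tri> _ _ b<x | tri≈ _ x≡c _ = inj₁ (2F , #-injective x≡c)
        ... | tri> _ _ a<x | tri> _ _ b<x | tri> _ _ c<x = inj₂ (1F , inj₂ c<x)

        corner∉ : ∀ i j → ¬ Sector i (e j)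
        corner∉ 0F 0F (b<a , _) = <-asym a<b b<a
        corner∉ 0F 1F (b<b , _) = <-irrefl refl b<b
        corner∉ 0F 2F (_ , c<c) = <-irrefl refl c<c
        corner∉ 1F 0F (inj₁ a<a) = <-irrefl refl a<a
        corner∉ 1F 0F (inj₂ c<a) = <-asym a<c c<a
        corner∉ 1F 1F (inj₁ b<a) = <-asym a<b b<a
        corner∉ 1F 1F (inj₂ c<b) = <-asym b<c c<b
        corner∉ 1F 2F (inj₁ c<a) = <-asym a<c c<a
        corner∉ 1F 2F (inj₂ c<c) = <-irrefl refl c<c
        corner∉ 2F 0F (a<a , _) = <-irrefl refl a<a
        corner∉ 2F 1F (_ , b<b) = <-irrefl refl b<b
        corner∉ 2F 2F (_ , c<b) = <-asym b<c c<b

        ¬0∧1 : ∀ {x} → Sector 0F x → ¬ Sector 1F x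
        ¬0∧1 (b<x , x<c) (inj₁ x<a) = <-asym (<-trans a<b b<x) x<a
        ¬0∧1 (b<x , x<c) (inj₂ c<x) = <-asym x<c c<x

        ¬0∧2 : ∀ {x} → Sector 0F x → ¬ Sector 2F x
        ¬0∧2 (b<x , _) (_ , x<b) = <-asym b<x x<b

        ¬2∧1 : ∀ {x} → Sector 2F x → ¬ Sector 1F x
        ¬2∧1 (a<x , x<b) (inj₁ x<a) = <-asym a<x x<a
        ¬2∧1 (a<x , x<b) (inj₂ c<x) = <-asym (<-trans x<b b<c) c<x

        disjoint : ∀ i j {x} → Sector i x → Sector j x → i ≡ j
        disjoint 0F 0F _ _ = refl
        disjoint 0F 1F p q = contradiction q (¬0∧1 p)
        disjoint 0F 2F p q = contradiction q (¬0∧2 p)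
        disjoint 1F 0F p q = contradiction p (¬0∧1 q)
        disjoint 1F 1F _ _ = refl
        disjoint 1F 2F p q = contradiction p (¬2∧1 q)
        disjoint 2F 0F p q = contradiction p (¬0∧2 q)
        disjoint 2F 1F p q = contradiction q (¬2∧1 p)
        disjoint 2F 2F _ _ = refl

        -- `confined` handles edges that start inside an interval, whereas sector 1 is the outside
        -- of one; so the edge is read from its end `y`.
        ¬1∧ac : ∀ {x y} → Inside a c y → x ~ y → ¬ Sector 1F x
        ¬1∧ac y-in x~y p with confined (sides λ ()) y-in (~-sym x~y)
        ... | inj₂ (inj₁ refl) = corner∉ 1F 0F p
        ... | inj₂ (inj₂ refl) = corner∉ 1F 2F p
        ¬1∧ac y-in x~y (inj₁ x<a) | inj₁ (a<x , _) = <-asym a<x x<a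
        ¬1∧ac y-in x~y (inj₂ c<x) | inj₁ (_ , x<c) = <-asym x<c c<x

        sep : ∀ i {x y} → Sector i x → x ~ y → Sector i y ⊎ (∃[ j ] j ≢ i × y ≡ e j)
        sep 0F p x~y with confined (sides λ ()) p x~y
        ... | inj₁ q         = inj₁ q
        ... | inj₂ (inj₁ eq) = inj₂ (1F , (λ ()) , eq)
        ... | inj₂ (inj₂ eq) = inj₂ (2F , (λ ()) , eq)
        sep 2F p x~y with confined (sides λ ()) p x~y
        ... | inj₁ q         = inj₁ q
        ... | inj₂ (inj₁ eq) = inj₂ (0F , (λ ()) , eq)
        ... | inj₂ (inj₂ eq) = inj₂ (1F , (λ ()) , eq)
        sep 1F {x} {y} p x~y with locate y
        ... | inj₁ (0F , eq)   = inj₂ (0F , (λ ()) , eq)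
        ... | inj₁ (1F , refl) = contradiction p (¬1∧ac (a<b , b<c) x~y)
        ... | inj₁ (2F , eq)   = inj₂ (2F , (λ ()) , eq)
        ... | inj₂ (0F , b<y , y<c) = contradiction p (¬1∧ac (<-trans a<b b<y , y<c) x~y)
        ... | inj₂ (1F , q)         = inj₁ q
        ... | inj₂ (2F , a<y , y<b) = contradiction p (¬1∧ac (a<y , <-trans y<b b<c) x~y)

        -- Of two vertices in one sector, each joined to both ends of the side, one edge from each
        -- cross. Which two depends on the order around the circle.
        ordered-apex : ∀ i {x y} → Sector i x → Sector i y → (∀ {j} → j ≢ i → x ~ e j)
                     → (∀ {j} → j ≢ i → y ~ e j) → ¬ (# x < # y)
        ordered-apex 0F (b<x , _) (_ , y<c) x~ y~ x<y =
          crossing b<x x<y y<c (~-sym (y~ λ ())) (x~ λ ())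
        ordered-apex 2F (a<x , _) (_ , y<b) x~ y~ x<y =
          crossing a<x x<y y<b (~-sym (y~ λ ())) (x~ λ ())
        ordered-apex 1F (inj₁ x<a) (inj₁ y<a) x~ y~ x<y =
          crossing x<y y<a a<c (x~ {0F} λ ()) (y~ {2F} λ ())
        ordered-apex 1F (inj₁ x<a) (inj₂ c<y) x~ y~ x<y =
          crossing x<a a<c c<y (x~ {2F} λ ()) (~-sym (y~ {0F} λ ()))
        ordered-apex 1F (inj₂ c<x) (inj₁ y<a) x~ y~ x<y =
          <-asym x<y (<-trans (<-trans y<a a<c) c<x)
        ordered-apex 1F (inj₂ c<x) (inj₂ c<y) x~ y~ x<y =
          crossing a<c c<x x<y (~-sym (x~ {0F} λ ())) (~-sym (y~ {2F} λ ()))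

      trisect : Trisection e
      trisect = record
        { Sector = Sector ; sector? = sector? ; locate = locate
        ; corner∉ = λ {i} {j} → corner∉ i j
        ; disjoint = λ {i} {j} → disjoint i j
        ; sep = λ {i} → sep i
        ; apex-unique = λ {i} {x} {y} p q x~ y~ → #-injective
            (≤-antisym (≮⇒≥ (ordered-apex i q p y~ x~)) (≮⇒≥ (ordered-apex i p q x~ y~))) }

    opposite-corner : ∀ {e F p q} → Triangle e F → p ∈ F → q ∈ F → p ≢ q
      → ∃[ x ] x ∈ F × x ~ p × x ~ q × (∀ {y} → y ∈ F → y ≡ p ⊎ y ≡ q ⊎ y ≡ x)
    opposite-corner {e} {F} tr p∈ q∈ p≢q with Triangle.∈-corner tr p∈ | Triangle.∈-corner tr q∈
    ... | i , refl | j , refl with remaining-corner i j (p≢q ∘ cong e)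
    ... | k , k≢i , k≢j = e k , corner∈ k , sides k≢i , sides k≢j , only
      where
      open Triangle tr
      only : ∀ {y} → y ∈ F → y ≡ e i ⊎ y ≡ e j ⊎ y ≡ e k
      only y∈ with ∈-corner y∈
      ... | l , refl with one-of-three i j k l (p≢q ∘ cong e) k≢i k≢j
      ... | inj₁ refl        = inj₁ refl
      ... | inj₂ (inj₁ refl) = inj₂ (inj₁ refl)
      ... | inj₂ (inj₂ refl) = inj₂ (inj₂ refl)

    -- Closed neighbourhoods as cliques of the square

    star-clique : ∀ {w u v} → u ≡ w ⊎ u ~ w → v ≡ w ⊎ v ~ w → u ≢ v → Adj² G u v
    star-clique (inj₁ refl) (inj₁ refl) u≢v = contradiction refl u≢v
    star-clique (inj₁ refl) (inj₂ v~w)  u≢v = u≢v , inj₁ (~-sym v~w)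
    star-clique (inj₂ u~w)  (inj₁ refl) u≢v = u≢v , inj₁ u~w
    star-clique (inj₂ u~w)  (inj₂ v~w)  u≢v = u≢v , inj₂ (_ , u~w , ~-sym v~w)

    star-size : ∀ {w S} → (∀ {y} → y ∈ S → y ≡ w ⊎ y ~ w) → ∣ S ∣ ≤ suc (deg G w)
    star-size {w} {S} star = ≤-trans (∣p∣≤1+∣p-x∣ S w) (s≤s (p⊆q⇒∣p∣≤∣q∣ S-w⊆N))
      where
      S-w⊆N : S - w ⊆ tabulate (adj w)
      S-w⊆N {y} y∈ with star (p─q⊆p S _ y∈)
      ... | inj₁ refl = contradiction y∈ (x∉p-x S w)
      ... | inj₂ y~w  = lookup⇒[]= y _ (trans (lookup∘tabulate (adj w) y) (Equivalence.to T-≡ (~-sym y~w)))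

    -- The neighbours of a face in the weak dual, and the cut

    module AroundFace {e F} (tr : Triangle e F) (ts : Trisection e) where
      open Triangle tr
      open Trisection ts

      sector-corner : ∀ {i j x} → Sector i x → x ~ e j → j ≢ i
      sector-corner p x~ej refl with sep p x~ej
      ... | inj₁ q            = corner∉ q
      ... | inj₂ (l , l≢i , eq) = l≢i (sym (corner-injective eq))

      -- `F′` is the triangle glued to the side opposite `e i`, with its apex `x` beyond that side.
      record Attached (F′ : Subset n) (i : Fin 3) (x : Fin n) : Set where
        field
          apex-sector : Sector i x
          apex-adj    : ∀ {j} → j ≢ i → x ~ e j
          apex∈       : x ∈ F′
          shared∈     : ∀ {j} → j ≢ i → e j ∈ F′
          ∈-attached  : ∀ {y} → y ∈ F′ → y ≡ x ⊎ (∃[ j ] j ≢ i × y ≡ e j)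

      -- The third corner `x` of `F′` is not a corner of `F`, or the two faces would coincide. So
      -- `x` lies in a sector, and being adjacent to both ends of the shared side it can only be the
      -- sector behind that side.
      dualAdj⇒attached : ∀ {e′ F′} → Triangle e′ F′ → DualAdj G F F′ → ∃[ i ] ∃[ x ] Attached F′ i x
      dualAdj⇒attached {F′ = F′} tr′ (F≢F′ , p , q , p≢q , p∈ , q∈ , p∈′ , q∈′ , _)
        with ∈-corner p∈ | ∈-corner q∈ | opposite-corner tr′ p∈′ q∈′ p≢q
      ... | j , refl | k , refl | x , x∈′ , x~p , x~q , only
        with remaining-corner j k (p≢q ∘ cong e)
      ... | i , i≢j , i≢k = i , x , record
        { apex-sector = in-sector ; apex-adj = adjacent ; apex∈ = x∈′ ; shared∈ = shared
        ; ∈-attached = members }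
        where
        cases : ∀ l → l ≡ j ⊎ l ≡ k ⊎ l ≡ i
        cases l = one-of-three j k i l (p≢q ∘ cong e) i≢j i≢k
        in-sector : Sector i x
        in-sector with locate x
        in-sector | inj₂ (l , p) with cases l
        ... | inj₁ refl        = contradiction refl (sector-corner p x~p)
        ... | inj₂ (inj₁ refl) = contradiction refl (sector-corner p x~q)
        ... | inj₂ (inj₂ refl) = p
        in-sector | inj₁ (l , refl) with cases l
        ... | inj₁ refl        = contradiction refl (~⇒≢ x~p)
        ... | inj₂ (inj₁ refl) = contradiction refl (~⇒≢ x~q)
        ... | inj₂ (inj₂ refl) = contradiction (⊆-antisym F⊆F′ F′⊆F) F≢F′
          where
          F⊆F′ : F ⊆ F′
          F⊆F′ y∈ with ∈-corner y∈
          ... | m , refl with cases m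
          ... | inj₁ refl        = p∈′
          ... | inj₂ (inj₁ refl) = q∈′
          ... | inj₂ (inj₂ refl) = x∈′
          F′⊆F : F′ ⊆ F
          F′⊆F y∈ with only y∈
          ... | inj₁ refl        = p∈
          ... | inj₂ (inj₁ refl) = q∈
          ... | inj₂ (inj₂ refl) = corner∈ i
        adjacent : ∀ {l} → l ≢ i → x ~ e l
        adjacent {l} l≢i with cases l
        ... | inj₁ refl        = x~p
        ... | inj₂ (inj₁ refl) = x~q
        ... | inj₂ (inj₂ refl) = contradiction refl l≢i
        shared : ∀ {l} → l ≢ i → e l ∈ F′
        shared {l} l≢i with cases l
        ... | inj₁ refl        = p∈′
        ... | inj₂ (inj₁ refl) = q∈′
        ... | inj₂ (inj₂ refl) = contradiction refl l≢i
        members : ∀ {y} → y ∈ F′ → y ≡ x ⊎ (∃[ l ] l ≢ i × y ≡ e l)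
        members y∈ with only y∈
        ... | inj₁ eq        = inj₂ (j , ≢-sym i≢j , eq)
        ... | inj₂ (inj₁ eq) = inj₂ (k , ≢-sym i≢k , eq)
        ... | inj₂ (inj₂ eq) = inj₁ eq

      attached-⊆ : ∀ {F₁ F₂ i x} → Attached F₁ i x → Attached F₂ i x → F₁ ⊆ F₂
      attached-⊆ A₁ A₂ y∈ with Attached.∈-attached A₁ y∈
      ... | inj₁ refl             = Attached.apex∈ A₂
      ... | inj₂ (_ , j≢i , refl) = Attached.shared∈ A₂ j≢i

      -- Each side carries at most one further face, so distinct neighbours of `F` occupy different
      -- sides.
      attached-unique : ∀ {F₁ F₂ i x y} → Attached F₁ i x → Attached F₂ i y → F₁ ≡ F₂
      attached-unique A₁ A₂ with apex-unique (Attached.apex-sector A₁) (Attached.apex-sector A₂)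
                                   (Attached.apex-adj A₁) (Attached.apex-adj A₂)
      ... | refl = ⊆-antisym (attached-⊆ A₁ A₂) (attached-⊆ A₂ A₁)

      attached-misses : ∀ {F′ i x} → Attached F′ i x → e i ∉ F′
      attached-misses A ei∈ with Attached.∈-attached A ei∈
      ... | inj₁ refl           = corner∉ (Attached.apex-sector A)
      ... | inj₂ (_ , j≢i , eq) = j≢i (sym (corner-injective eq))

      -- A vertex beyond the third side would give `e i` and `e j` a common neighbour there, hence a
      -- further face adjacent to `F`. It contains `e i`, which `F₁` misses, and `e j`, which `F₂`
      -- misses.
      third-sector-empty : Biconnected G → Chordal G
        → ∀ {i j k F₁ F₂ x₁ x₂} → i ≢ j → k ≢ i → k ≢ j → Attached F₁ i x₁ → Attached F₂ j x₂
        → (∀ F′ → IsFace G pos F′ → DualAdj G F F′ → F′ ≡ F₁ ⊎ F′ ≡ F₂)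
        → ∀ {c} → ¬ Sector k c
      third-sector-empty bic chordal {i} {j} {k} i≢j k≢i k≢j A₁ A₂ only-two ck
        with Region.common-neighbour (Sector k) bic chordal (sides i≢j) corner∉ corner∉ closed ck
        where
        closed : ∀ {x y} → Sector k x → x ~ y → Sector k y ⊎ y ≡ e i ⊎ y ≡ e j
        closed p x~y with sep p x~y
        ... | inj₁ q = inj₁ q
        ... | inj₂ (l , l≢k , refl) with one-of-three i j k l i≢j k≢i k≢j
        ... | inj₁ refl        = inj₂ (inj₁ refl)
        ... | inj₂ (inj₁ refl) = inj₂ (inj₂ refl)
        ... | inj₂ (inj₂ refl) = contradiction refl l≢k
      ... | z , kz , z~i , z~j = absurd (only-two F₃ (triangle-isFace tr₃) dual)
        where
        corner₃? = λ y → (y ≟ e i) ⊎-dec ((y ≟ e j) ⊎-dec (y ≟ z))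
        F₃ : Subset n
        F₃ = select corner₃?
        i∈ : e i ∈ F₃
        i∈ = ∈-select⁺ corner₃? (inj₁ refl)
        j∈ : e j ∈ F₃
        j∈ = ∈-select⁺ corner₃? (inj₂ (inj₁ refl))
        z∈ : z ∈ F₃
        z∈ = ∈-select⁺ corner₃? (inj₂ (inj₂ refl))
        tr₃ : Triangle (corners (e i) (e j) z) F₃
        tr₃ = triangle (sides i≢j) (~-sym z~j) (~-sym z~i) i∈ j∈ z∈ (∈-select⁻ corner₃?)
        z∉F : z ∉ F
        z∉F z∈F with ∈-corner z∈F
        ... | _ , refl = corner∉ kz
        dual : DualAdj G F F₃
        dual = (λ F≡F₃ → z∉F (subst (z ∈_) (sym F≡F₃) z∈)) , e i , e j , ~⇒≢ (sides i≢j) ,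
          corner∈ i , corner∈ j , i∈ , j∈ , sides i≢j
        absurd : ¬ (F₃ ≡ _ ⊎ F₃ ≡ _)
        absurd (inj₁ eq) = attached-misses A₁ (subst (e i ∈_) eq i∈)
        absurd (inj₂ eq) = attached-misses A₂ (subst (e j ∈_) eq j∈)

      -- With sector k empty, a path of length 2 that leaves sector i and avoids
      -- the corners at its ends passes through e k.
      sector-cut : ∀ {i j k a b x} → i ≢ j → k ≢ i → k ≢ j → deg G (e k) ≤ 6
        → (∀ {c} → ¬ Sector k c) → Sector i a → ¬ a ~ e k → Sector j b → Sector i x → x ~ e k
        → ∃[ S ] ∃[ P ] Cut S P
      sector-cut {i} {j} {k} {a} {b} {x} i≢j k≢i k≢j deg≤6 empty ia a≁w jb ix x~w =
        S , P , 4≤S , ≤-trans (star-size star) (s≤s deg≤6)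
        , (λ _ _ u∈ v∈ → star-clique (star u∈) (star v∈))
        , (a , a∉S , ∈-select⁺ (sector? i) ia)
        , (b , b∉S , λ b∈P → i≢j (disjoint (∈-select⁻ (sector? i) b∈P) jb))
        , λ _ _ p∉ q∉ p∈P (_ , p²q) → ∈-select⁺ (sector? i) (closed p∉ q∉ (∈-select⁻ (sector? i) p∈P) p²q)
        where
        w = e k
        inS? = λ y → any? (λ l → y ≟ e l) ⊎-dec (sector? i y ×-dec (y ~? w))
        S P : Subset n
        S = select inS?
        P = select (sector? i)
        corner∈S : ∀ l → e l ∈ S
        corner∈S l = ∈-select⁺ inS? (inj₁ (l , refl))
        star : ∀ {y} → y ∈ S → y ≡ w ⊎ y ~ w
        star y∈ with ∈-select⁻ inS? y∈
        ... | inj₂ (_ , y~w) = inj₂ y~w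
        ... | inj₁ (l , refl) with l ≟ k
        ... | yes refl = inj₁ refl
        ... | no l≢k   = inj₂ (sides l≢k)
        a∉S : a ∉ S
        a∉S a∈ with ∈-select⁻ inS? a∈
        ... | inj₁ (_ , refl) = corner∉ ia
        ... | inj₂ (_ , a~w)  = a≁w a~w
        b∉S : b ∉ S
        b∉S b∈ with ∈-select⁻ inS? b∈
        ... | inj₁ (_ , refl) = corner∉ jb
        ... | inj₂ (ib , _)   = i≢j (disjoint ib jb)
        x≢corner : ∀ {l} → x ≢ e l
        x≢corner refl = corner∉ ix
        ≢-corner : ∀ {l m} → l ≢ m → e l ≢ e m
        ≢-corner l≢m = ~⇒≢ (sides l≢m)
        4≤S : 4 ≤ ∣ S ∣
        -- The fourth element besides the corners is `x`, a neighbour of `w` in sector `i`.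
        4≤S = ≤-trans (s≤s (≤-trans (s≤s (≤-trans (s≤s (≤-trans (s≤s z≤n)
          (x∈p⇒∣p-x∣<∣p∣ (x∈p∧x≢y⇒x∈p-y (x∈p∧x≢y⇒x∈p-y (x∈p∧x≢y⇒x∈p-y
            (∈-select⁺ inS? (inj₂ (ix , x~w))) x≢corner) x≢corner) x≢corner))))
          (x∈p⇒∣p-x∣<∣p∣ (x∈p∧x≢y⇒x∈p-y (x∈p∧x≢y⇒x∈p-y (corner∈S 2F) (≢-corner λ ())) (≢-corner λ ())))))
          (x∈p⇒∣p-x∣<∣p∣ (x∈p∧x≢y⇒x∈p-y (corner∈S 1F) (≢-corner λ ())))))
          (x∈p⇒∣p-x∣<∣p∣ (corner∈S 0F))
        step-closed : ∀ {p q} → q ∉ S → Sector i p → p ~ q → Sector i q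
        step-closed q∉ ip p~q with sep ip p~q
        ... | inj₁ iq = iq
        ... | inj₂ (l , _ , refl) = contradiction (corner∈S l) q∉
        closed : ∀ {p q} → p ∉ S → q ∉ S → Sector i p → p ~ q ⊎ (∃[ r ] p ~ r × r ~ q) → Sector i q
        closed p∉ q∉ ip (inj₁ p~q) = step-closed q∉ ip p~q
        closed {p} {q} p∉ q∉ ip (inj₂ (r , p~r , r~q)) with sep ip p~r
        ... | inj₁ ir = step-closed q∉ ir r~q
        ... | inj₂ (l , l≢i , refl) with one-of-three i j k l i≢j k≢i k≢j
        ... | inj₁ refl        = contradiction refl l≢i
        ... | inj₂ (inj₂ refl) = contradiction (∈-select⁺ inS? (inj₂ (ip , p~r))) p∉
        -- The middle vertex is `e j`, which has no neighbour in its own opposite sector `j`; as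
        -- sector `k` is empty, `q` is back in sector `i`.
        ... | inj₂ (inj₁ refl) with locate q
        ... | inj₁ (m , refl) = contradiction (corner∈S m) q∉
        ... | inj₂ (m , mq) with one-of-three i j k m i≢j k≢i k≢j
        ... | inj₁ refl        = mq
        ... | inj₂ (inj₁ refl) = contradiction refl (sector-corner mq (~-sym r~q))
        ... | inj₂ (inj₂ refl) = contradiction mq empty

      -- The two apexes do double duty: on the side that is cut, the apex is the neighbour of `e k`
      -- that enlarges the clique to four; the other apex is the vertex cut off from it.
      two-sectors : ∀ {i j k F₁ F₂ x₁ x₂} → i ≢ j → k ≢ i → k ≢ j → deg G (e k) ≤ 6
        → (∀ {c} → ¬ Sector k c) → Attached F₁ i x₁ → Attached F₂ j x₂ → CompleteOrCut
      two-sectors {i} {j} {k} i≢j k≢i k≢j deg≤6 empty A₁ A₂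
        with any? (λ a → sector? i a ×-dec ¬? (a ~? e k)) | any? (λ a → sector? j a ×-dec ¬? (a ~? e k))
      ... | yes (a , ia , a≁w) | _ = inj₂ (sector-cut i≢j k≢i k≢j deg≤6 empty ia a≁w
              (Attached.apex-sector A₂) (Attached.apex-sector A₁) (Attached.apex-adj A₁ k≢i))
      ... | no _ | yes (a , ja , a≁w) = inj₂ (sector-cut (≢-sym i≢j) k≢j k≢i deg≤6 empty ja a≁w
              (Attached.apex-sector A₁) (Attached.apex-sector A₂) (Attached.apex-adj A₂ k≢j))
      ... | no i⊆N | no j⊆N = inj₁ λ u v → star-clique (near u) (near v)
        where
        near : ∀ y → y ≡ e k ⊎ y ~ e k
        near y with locate y
        near y | inj₁ (l , refl) with l ≟ k
        ... | yes refl = inj₁ refl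
        ... | no l≢k   = inj₂ (sides l≢k)
        near y | inj₂ (l , ly) with one-of-three i j k l i≢j k≢i k≢j
        ... | inj₁ refl        = inj₂ (decidable-stable (y ~? e k) λ y≁w → i⊆N (y , ly , y≁w))
        ... | inj₂ (inj₁ refl) = inj₂ (decidable-stable (y ~? e k) λ y≁w → j⊆N (y , ly , y≁w))
        ... | inj₂ (inj₂ refl) = contradiction ly empty

      two-attached : Biconnected G → Chordal G → (∀ v → deg G v ≤ 6) → ∀ {F₁ F₂} → F₁ ≢ F₂
        → (∀ F′ → IsFace G pos F′ → DualAdj G F F′ → F′ ≡ F₁ ⊎ F′ ≡ F₂)
        → ∃[ i ] ∃[ x ] Attached F₁ i x → ∃[ j ] ∃[ y ] Attached F₂ j y → CompleteOrCut
      two-attached bic chordal deg≤6 F₁≢F₂ only-two (i , x , A₁) (j , y , A₂) with i ≟ j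
      ... | yes refl = contradiction (attached-unique A₁ A₂) F₁≢F₂
      ... | no i≢j with remaining-corner i j i≢j
      ... | k , k≢i , k≢j = two-sectors i≢j k≢i k≢j (deg≤6 (e k))
              (third-sector-empty bic chordal i≢j k≢i k≢j A₁ A₂ only-two) A₁ A₂

    -- From a face of degree 2 to the conclusion

    degree2⇒completeOrCut : Biconnected G → Chordal G → (∀ v → deg G v ≤ 6)
      → ∀ {F} → IsFace G pos F → HasDegree2 (IsFace G pos) (DualAdj G) F → CompleteOrCut
    degree2⇒completeOrCut bic chordal deg≤6 face
      (F₁ , F₂ , face₁ , face₂ , F₁≢F₂ , dual₁ , dual₂ , only-two) =
      let (_ , inc , tr)  = face⇒triangle bic chordal face
          (_ , _   , tr₁) = face⇒triangle bic chordal face₁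
          (_ , _   , tr₂) = face⇒triangle bic chordal face₂
          open AroundFace tr (trisect inc (Triangle.sides tr))
      in two-attached bic chordal deg≤6 F₁≢F₂ only-two
           (dualAdj⇒attached tr₁ dual₁) (dualAdj⇒attached tr₂ dual₂)

theorem4p9 : ∀ {n : ℕ} (G : SimpleGraph n) (pos : Fin n → Fin n)
    → InjectiveFn pos → NonCrossing G pos
    → Biconnected G → Chordal G
    → HasMaxDegree G 5 ⊎ HasMaxDegree G 6
    → ¬ Full (IsFace G pos) (DualAdj G)
    → Complete² G ⊎ Σ ℕ (λ h → 4 ≤ h × h ≤ 7 × HasSeparator G h)
theorem4p9 G pos pos-injective nc bic chordal maxdeg ¬full = conclude
  -- The face of degree 2 is met only inside the refutation of `none`; decidability then removes the
  -- double negation.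
  (decidable-stable CompleteOrCut? λ none → ¬full λ F face deg2 →
    none (degree2⇒completeOrCut bic chordal (deg≤6 maxdeg) face deg2))
  where
  open GraphTheory G
  open Outerplane pos pos-injective nc
  deg≤6 : HasMaxDegree G 5 ⊎ HasMaxDegree G 6 → ∀ v → deg G v ≤ 6
  deg≤6 (inj₁ (deg≤5 , _)) v = m≤n⇒m≤1+n (deg≤5 v)
  deg≤6 (inj₂ (deg≤6 , _)) v = deg≤6 v
  conclude : CompleteOrCut → Complete² G ⊎ Σ ℕ (λ h → 4 ≤ h × h ≤ 7 × HasSeparator G h)
  conclude (inj₁ complete)      = inj₁ complete
  conclude (inj₂ (_ , _ , cut)) = inj₂ (Cut⇒HasSeparator cut)
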